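{- For all $n\geq1$ and all $k\geq1$ (natural number) or $k=\mathbb{N}$: $\widehat{\mathrm{RT}_{n,k}}\leq_{sW}\mathrm{RT}_{n+2,2}$ and $\widehat{\mathrm{SRT}_{n,k}}\leq_{sW}\mathrm{SRT}_{n+2,2}$.
   Context: Weihrauch framework. A represented space is a set $X$ with a surjective partial map $\delta_X:\subseteq\mathbb{N}^{\mathbb{N}}\to X$. A problem is a partial multi-valued function $f:\subseteq X\rightrightarrows Y$; a partial $F:\subseteq\mathbb{N}^{\mathbb{N}}\to\mathbb{N}^{\mathbb{N}}$ realizes $f$ if $\delta_Y(F(p))\in f(\delta_X(p))$ whenever $\delta_X(p)\in\mathrm{dom}(f)$. $f\leq_{sW}g$ means there are computable partial $H,K:\subseteq\mathbb{N}^{\mathbb{N}}\to\mathbb{N}^{\mathbb{N}}$ with $H\circ G\circ K$ realizing $f$ for every realizer $G$ of $g$. The parallelization $\widehat{f}:\subseteq X^{\mathbb{N}}\rightrightarrows Y^{\mathbb{N}}$ maps $(x_i)_i$ (with all $x_i\in\mathrm{dom}(f)$) to $\prod_i f(x_i)$, sequences being represented by $\langle p_0,p_1,\dots\rangle$ with $\langle p_0,p_1,\dots\rangle\langle n,j\rangle=p_n(j)$ for a standard pairing $\langle n,j\rangle$. Ramsey. $[\mathbb{N}]^n$ is the set of $n$-element subsets of $\mathbb{N}$; $k$ is identified with $\{0,\dots,k-1\}$. $\mathcal{C}_{n,k}$ ($k\in\mathbb{N}$) is the set of colorings $c:[\mathbb{N}]^n\to k$ and $\mathcal{C}_{n,\mathbb{N}}$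 the set of $c:[\mathbb{N}]^n\to\mathbb{N}$ with finite range, represented by names $p$ with $p(i)=c(\vartheta_n(i))$ for a fixed standard computable bijection $\vartheta_n:\mathbb{N}\to[\mathbb{N}]^n$. $M$ is homogeneous for $c$ if $c$ is constant on $[M]^n$. $c$ is stable if $\lim_{i\to\infty}c(A\cup\{i\})$ exists for all $A\in[\mathbb{N}]^{n-1}$. $\mathrm{RT}_{n,k}:\mathcal{C}_{n,k}\rightrightarrows2^{\mathbb{N}}$ maps $c$ to the set of characteristic functions of infinite homogeneous sets for $c$; $\mathrm{SRT}_{n,k}$ is its restriction to stable colorings. -}

module Defs where

open import Data.Nat using (ℕ; zero; suc; _+_; _*_; _<_; _≤_)
open import Data.Nat.Combinatorics using (_C_)
open import Data.Fin using (Fin; toℕ) renaming (_<_ to _<ᶠ_)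
open import Data.Vec using (Vec; []; _∷_; lookup; tabulate; sum; _∷ʳ_)
open import Data.Product using (Σ; ∃; _×_; _,_; proj₁)
open import Data.Sum using (_⊎_)
open import Data.Unit using (⊤)
open import Relation.Binary.PropositionalEquality using (_≡_)

Baire : Set
Baire = ℕ → ℕ

-- Oracle (Kleene) μ-recursive codes: a model of computation relative
-- to an oracle α ∈ ℕ^ℕ.  A partial F :⊆ ℕ^ℕ → ℕ^ℕ is computable iff
-- there is a code e : Code 1 with F(α)(j) = Φ_e^α(j).

data Code : ℕ → Set where
  zer  : Code 0
  succ : Code 1
  proj : ∀ {n} → Fin n → Code n
  orc  : Code 1
  comp : ∀ {n m} → Code m → Vec (Code n) m → Code n
  prec : ∀ {n} → Code n → Code (suc (suc n)) → Code (suc n)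
  mu   : ∀ {n} → Code (suc n) → Code n

mutual
  data Eval (α : Baire) : ∀ {n} → Code n → Vec ℕ n → ℕ → Set where
    ev-zer  : Eval α zer [] 0
    ev-succ : ∀ {x} → Eval α succ (x ∷ []) (suc x)
    ev-proj : ∀ {n} {i : Fin n} {xs} → Eval α (proj i) xs (lookup xs i)
    ev-orc  : ∀ {x} → Eval α orc (x ∷ []) (α x)
    ev-comp : ∀ {n m} {f : Code m} {gs : Vec (Code n) m} {xs ys y} →
              EvalAll α gs xs ys → Eval α f ys y → Eval α (comp f gs) xs y
    ev-prec0 : ∀ {n} {f : Code n} {g xs y} →
               Eval α f xs y → Eval α (prec f g) (0 ∷ xs) y
    ev-precS : ∀ {n} {f : Code n} {g x xs y z} →
               Eval α (prec f g) (x ∷ xs) y → Eval α g (x ∷ y ∷ xs) z →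
               Eval α (prec f g) (suc x ∷ xs) z
    ev-mu   : ∀ {n} {f : Code (suc n)} {xs y} →
              Eval α f (y ∷ xs) 0 →
              (∀ i → i < y → Σ ℕ λ v → Eval α f (i ∷ xs) (suc v)) →
              Eval α (mu f) xs y

  data EvalAll (α : Baire) : ∀ {n m} → Vec (Code n) m → Vec ℕ n → Vec ℕ m → Set where
    ev-[] : ∀ {n} {xs : Vec ℕ n} → EvalAll α [] xs []
    ev-∷  : ∀ {n m} {g : Code n} {gs : Vec (Code n) m} {xs y ys} →
            Eval α g xs y → EvalAll α gs xs ys → EvalAll α (g ∷ gs) xs (y ∷ ys)

Computes : Code 1 → Baire → Baire → Set
Computes e α β = ∀ j → Eval α e (j ∷ []) (β j)

-- Problems, at the level of names (all spaces here are represented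
-- over ℕ^ℕ).  Dom p : p is a name of an element of dom(f);
-- Sol p q : q is a name of an element of f(δ(p)).

record Problem : Set₁ where
  field
    Dom : Baire → Set
    Sol : Baire → Baire → Set
open Problem public

Realizer : Problem → Set
Realizer g = Σ ((p : Baire) → Dom g p → Baire) λ G → ∀ p (d : Dom g p) → Sol g p (G p d)

_≤sW_ : Problem → Problem → Set
f ≤sW g = Σ (Code 1) λ eK → Σ (Code 1) λ eH →
  (R : Realizer g) → ∀ p → Dom f p →
    Σ Baire λ k → Computes eK p k × Σ (Dom g k) λ d →
      Σ Baire λ h → Computes eH (proj₁ R k d) h × Sol f p h

tri : ℕ → ℕ
tri zero    = 0
tri (suc s) = tri s + suc s

pair : ℕ → ℕ → ℕ
pair n j = tri (n + j) + j

component : Baire → ℕ → Baire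
component α n j = α (pair n j)

parallel : Problem → Problem
parallel f = record
  { Dom = λ α → ∀ i → Dom f (component α i)
  ; Sol = λ α β → ∀ i → Sol f (component α i) (component β i) }

-- n-element subsets of ℕ as strictly increasing vectors, and the fixed
-- computable bijection θ_n : ℕ → [ℕ]^n, given through its inverse
-- (combinatorial number system / colex rank):
--   rank {x₀ < … < x_{n-1}} = Σ_i C(x_i, i+1).

Increasing : ∀ {n} → Vec ℕ n → Set
Increasing {n} xs = (i j : Fin n) → i <ᶠ j → lookup xs i < lookup xs j

rank : ∀ {n} → Vec ℕ n → ℕ
rank {n} xs = sum (tabulate λ (i : Fin n) → lookup xs i C suc (toℕ i))

colour : ∀ {n} → Baire → Vec ℕ n → ℕ
colour p A = p (rank A)

data Colours : Set where
  fin   : ℕ → Colours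
  omega : Colours

InRange : Colours → Baire → Set
InRange (fin k) p = ∀ i → p i < k
InRange omega   p = ∃ λ b → ∀ i → p i < b

ValidColours : Colours → Set
ValidColours (fin k) = 1 ≤ k
ValidColours omega   = ⊤

Stable : ℕ → Baire → Set
Stable zero    p = ⊤
Stable (suc m) p = (A : Vec ℕ m) → Increasing A →
  Σ ℕ λ col → Σ ℕ λ N → ∀ i → N < i → Increasing (A ∷ʳ i) → colour p (A ∷ʳ i) ≡ col

CharFn : Baire → Set
CharFn q = ∀ i → q i ≡ 0 ⊎ q i ≡ 1

Infinite : Baire → Set
Infinite q = ∀ m → Σ ℕ λ i → m ≤ i × q i ≡ 1

Homogeneous : (n : ℕ) → Baire → Baire → Set
Homogeneous n p q = Σ ℕ λ col → (A : Vec ℕ n) → Increasing A →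
  (∀ i → q (lookup A i) ≡ 1) → colour p A ≡ col

RTsol : ℕ → Baire → Baire → Set
RTsol n p q = CharFn q × Infinite q × Homogeneous n p q

RT : ℕ → Colours → Problem
RT n k = record { Dom = InRange k ; Sol = RTsol n }

SRT : ℕ → Colours → Problem
SRT n k = record { Dom = λ p → InRange k p × Stable n p ; Sol = RTsol n }

{-# OPTIONS --safe #-}

-- Colour m ∷ B, where B has n + 1 elements, by 0 iff each of c₀, …, cₘ gives
-- init B and tail B the same colour.  An infinite homogeneous set M for this
-- colouring has colour 0, because a colouring of [M]ⁿ with finitely many colours
-- cannot separate init B from tail B for all B (the shift graph has infinite
-- chromatic number); so Ramsey's theorem itself is not needed.  Deleting from M
-- everything up to its first element ≥ i leaves a set on which cᵢ is invariant
-- under sliding an n-element window, hence homogeneous for cᵢ.  This set is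
-- computed from M alone, which gives strong reducibility, and limits of the cᵢ
-- yield limits of the new colouring, which gives the stable case.

module Submission where

open import Defs
open import Data.Nat using (ℕ; zero; suc; pred; _+_; _*_; _∸_; _^_; _≤_; _<_; z≤n; s≤s; _≤?_; _≟_)
open import Data.Nat.Properties
open import Data.Nat.Combinatorics using (_C_; nC1≡n; nCn≡1; k>n⇒nCk≡0; nCk+nC[k+1]≡[n+1]C[k+1])
open import Data.Fin using (Fin; toℕ; fromℕ<; inject₁; funToFin; finToFun)
  renaming (zero to fzero; suc to fsuc)
open import Data.Fin.Properties
  using (toℕ-inject₁; toℕ<n; toℕ-fromℕ<; fromℕ<-injective; pigeonhole; finToFun-funToFin)
  renaming (_≟_ to _≟ᶠ_)
open import Data.Vec using (Vec; []; _∷_; head; tail; init; initLast; lookup; map; tabulate; sum; _∷ʳ_)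
open import Data.Vec.Properties
  using (lookup-map; lookup∘tabulate; tabulate∘lookup; tabulate-cong; init-∷ʳ)
open import Data.Product using (Σ; ∃; _×_; _,_; proj₁; proj₂)
open import Data.Sum using (_⊎_; inj₁; inj₂)
open import Function using (_∘_)
open import Relation.Binary.PropositionalEquality
open import Relation.Nullary using (Dec; yes; no; contradiction)

-- A superscript ᶜ marks closure properties of the computable functionals, all of
-- which are total (in fact primitive recursive), so μ is never used.

private variable
  k m n : ℕ

-- `eval` asserts convergence on every oracle and every input, so an inhabitant is a program
-- together with its verification.
record Computable (f : Baire → Vec ℕ n → ℕ) : Set where
  constructor _,_
  field
    code  : Code n
    eval  : ∀ α xs → Eval α code xs (f α xs)
open Computable

record ComputableVec (F : Baire → Vec ℕ n → Vec ℕ m) : Set where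
  constructor _,_
  field
    codes : Vec (Code n) m
    evals : ∀ α xs → EvalAll α codes xs (F α xs)

private variable
  f g : Baire → Vec ℕ n → ℕ
  F : Baire → Vec ℕ n → Vec ℕ m

extᶜ : (∀ α xs → f α xs ≡ g α xs) → Computable f → Computable g
extᶜ f≗g (e , ev) = e , λ α xs → subst (Eval α e xs) (f≗g α xs) (ev α xs)

projᶜ : (i : Fin n) → Computable (λ _ xs → lookup xs i)
projᶜ i = proj i , λ _ _ → ev-proj

compᶜ : {h : Baire → Vec ℕ m → ℕ} → Computable h → ComputableVec F →
        Computable (λ α (xs : Vec ℕ n) → h α (F α xs))
compᶜ (e , ev) (es , evs) = comp e es , λ α xs → ev-comp (evs α xs) (ev α _)

[]ᶜ : ComputableVec {n} (λ _ _ → [])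
[]ᶜ = [] , λ _ _ → ev-[]

infixr 5 _∷ᶜ_
_∷ᶜ_ : Computable f → ComputableVec F → ComputableVec (λ α xs → f α xs ∷ F α xs)
(e , ev) ∷ᶜ (es , evs) = (e ∷ es) , λ α xs → ev-∷ (ev α xs) (evs α xs)

_∷ʳᶜ_ : ComputableVec F → Computable f → ComputableVec (λ α xs → F α xs ∷ʳ f α xs)
(es , evs) ∷ʳᶜ (e , ev) = (es ∷ʳ e) , λ α xs → snoc (evs α xs) (ev α xs)
  where
  snoc : ∀ {α} {es : Vec (Code n) m} {e xs ys y} →
         EvalAll α es xs ys → Eval α e xs y → EvalAll α (es ∷ʳ e) xs (ys ∷ʳ y)
  snoc ev-[]         ev = ev-∷ ev ev-[]
  snoc (ev-∷ v evs) ev = ev-∷ v (snoc evs ev)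

headᶜ : ComputableVec {n} {suc m} F → Computable (λ α xs → head (F α xs))
headᶜ ((e ∷ _) , evs) = e , λ α xs → hd (evs α xs)
  where
  hd : ∀ {α} {es : Vec (Code n) (suc m)} {xs ys} →
       EvalAll α es xs ys → Eval α (head es) xs (head ys)
  hd (ev-∷ ev _) = ev

tailᶜ : ComputableVec {n} {suc m} F → ComputableVec (λ α xs → tail (F α xs))
tailᶜ (es , evs) = tail es , λ α xs → tl (evs α xs)
  where
  tl : ∀ {α} {es : Vec (Code n) (suc m)} {xs ys} →
       EvalAll α es xs ys → EvalAll α (tail es) xs (tail ys)
  tl (ev-∷ _ evs) = evs

initᶜ : ComputableVec {n} {suc m} F → ComputableVec (λ α xs → init (F α xs))
initᶜ (es , evs) = init es , λ α xs → ini (evs α xs)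
  where
  ini : ∀ {m α} {es : Vec (Code n) (suc m)} {xs ys} →
        EvalAll α es xs ys → EvalAll α (init es) xs (init ys)
  ini {m = zero}  (ev-∷ _ ev-[]) = ev-[]
  ini {m = suc m} (ev-∷ ev evs)  = ev-∷ ev (ini evs)

tabulateᶜ : {f : Baire → Vec ℕ n → Fin m → ℕ} → (∀ i → Computable (λ α xs → f α xs i)) →
            ComputableVec (λ α xs → tabulate (f α xs))
tabulateᶜ {m = zero}  fᶜ = []ᶜ
tabulateᶜ {m = suc m} fᶜ = fᶜ fzero ∷ᶜ tabulateᶜ (fᶜ ∘ fsuc)

idᶜ : ComputableVec {n} (λ _ xs → xs)
idᶜ .ComputableVec.codes = tabulateᶜ projᶜ .ComputableVec.codes
idᶜ .ComputableVec.evals α xs =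
  subst (EvalAll α _ xs) (tabulate∘lookup xs) (tabulateᶜ projᶜ .ComputableVec.evals α xs)

oracleᶜ : Computable f → Computable (λ α xs → α (f α xs))
oracleᶜ fᶜ = compᶜ {h = λ α xs → α (head xs)} (orc , λ { _ (_ ∷ []) → ev-orc }) (fᶜ ∷ᶜ []ᶜ)

zeroᶜ : Computable {n} (λ _ _ → 0)
zeroᶜ = comp zer [] , λ _ _ → ev-comp ev-[] ev-zer

sucᶜ : Computable f → Computable (λ α xs → suc (f α xs))
sucᶜ fᶜ = compᶜ {h = λ _ xs → suc (head xs)} (succ , λ { _ (_ ∷ []) → ev-succ }) (fᶜ ∷ᶜ []ᶜ)

constᶜ : ∀ c → Computable {n} (λ _ _ → c)
constᶜ zero    = zeroᶜ
constᶜ (suc c) = sucᶜ (constᶜ c)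

-- `h` enters through its recursion equations instead of a recursor, so that functions defined by
-- pattern matching qualify directly.
recᶜ : {h : Baire → Vec ℕ (suc n) → ℕ} {f : Baire → Vec ℕ n → ℕ} {g : Baire → Vec ℕ (2 + n) → ℕ} →
       Computable f → Computable g →
       (∀ α xs → f α xs ≡ h α (0 ∷ xs)) →
       (∀ α x xs → g α (x ∷ h α (x ∷ xs) ∷ xs) ≡ h α (suc x ∷ xs)) →
       Computable h
recᶜ {h = h} (e , ev) (e′ , ev′) base step = prec e e′ , λ { α (x ∷ xs) → go α x xs }
  where
  go : ∀ α x xs → Eval α (prec e e′) (x ∷ xs) (h α (x ∷ xs))
  go α zero    xs = subst (Eval α _ _) (base α xs) (ev-prec0 (ev α xs))
  go α (suc x) xs = subst (Eval α _ _) (step α x xs) (ev-precS (go α x xs) (ev′ α _))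

-- Computable arithmetic

pattern v₀ = fzero
pattern v₁ = fsuc v₀
pattern v₂ = fsuc v₁

Computable₂ : (ℕ → ℕ → ℕ) → Set
Computable₂ _∙_ = Computable {2} λ _ xs → head xs ∙ head (tail xs)

lift₂ : {_∙_ : ℕ → ℕ → ℕ} → Computable₂ _∙_ → Computable f → Computable g →
        Computable (λ α xs → f α xs ∙ g α xs)
lift₂ ∙ᶜ fᶜ gᶜ = compᶜ ∙ᶜ (fᶜ ∷ᶜ gᶜ ∷ᶜ []ᶜ)

infixl 6 _+ᶜ_ _∸ᶜ_
infixl 7 _*ᶜ_

_+ᶜ_ : Computable f → Computable g → Computable (λ α xs → f α xs + g α xs)
_+ᶜ_ = lift₂ {_∙_ = _+_} (recᶜ (projᶜ v₀) (sucᶜ (projᶜ v₁)) (λ { _ (_ ∷ []) → refl }) (λ _ _ _ → refl))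

_*ᶜ_ : Computable f → Computable g → Computable (λ α xs → f α xs * g α xs)
_*ᶜ_ = lift₂ {_∙_ = _*_} (recᶜ zeroᶜ (projᶜ v₂ +ᶜ projᶜ v₁) (λ _ _ → refl) (λ { _ _ (_ ∷ []) → refl }))

predᶜ : Computable f → Computable (λ α xs → pred (f α xs))
predᶜ fᶜ = compᶜ {h = λ _ xs → pred (head xs)}
  (recᶜ zeroᶜ (projᶜ v₀) (λ _ _ → refl) (λ _ _ _ → refl)) (fᶜ ∷ᶜ []ᶜ)

_∸ᶜ_ : Computable f → Computable g → Computable (λ α xs → f α xs ∸ g α xs)
-- Primitive recursion runs over the first argument, so the subtrahend is put first and the two
-- arguments are passed in reverse order.
fᶜ ∸ᶜ gᶜ = lift₂ {_∙_ = λ b a → a ∸ b}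
  (recᶜ (projᶜ v₀) (predᶜ (projᶜ v₁)) (λ { _ (_ ∷ []) → refl })
    (λ { _ b (a ∷ []) → pred[m∸n]≡m∸[1+n] a b })) gᶜ fᶜ

sumBelow : (ℕ → ℕ) → ℕ → ℕ
sumBelow f zero    = 0
sumBelow f (suc n) = sumBelow f n + f n

sumBelowᶜ : {f : Baire → Vec ℕ (suc n) → ℕ} → Computable f → Computable g →
            Computable (λ α xs → sumBelow (λ i → f α (i ∷ xs)) (g α xs))
sumBelowᶜ {f = f} fᶜ gᶜ = compᶜ {h = λ α xs → sumBelow (λ i → f α (i ∷ tail xs)) (head xs)}
  (recᶜ zeroᶜ (projᶜ v₁ +ᶜ compᶜ fᶜ (projᶜ v₀ ∷ᶜ tailᶜ (tailᶜ idᶜ))) (λ _ _ → refl) (λ _ _ _ → refl))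
  (gᶜ ∷ᶜ idᶜ)

sumᶜ : ∀ n → Computable {n} (λ _ xs → sum xs)
sumᶜ zero    = extᶜ (λ { _ [] → refl }) zeroᶜ
sumᶜ (suc n) = extᶜ (λ { _ (_ ∷ _) → refl }) (projᶜ v₀ +ᶜ compᶜ (sumᶜ n) (tailᶜ idᶜ))

binomialᶜ : ∀ k → Computable f → Computable (λ α xs → f α xs C k)
binomialᶜ k fᶜ = compᶜ {h = λ _ xs → head xs C k} (binomial k) (fᶜ ∷ᶜ []ᶜ)
  where
  -- For each fixed `k`, Pascal's rule is a primitive recursion in the upper argument; the induction
  -- on `k` happens outside the codes.
  binomial : ∀ k → Computable {1} (λ _ xs → head xs C k)
  binomial zero    = constᶜ 1
  binomial (suc k) = recᶜ zeroᶜ (compᶜ (binomial k) (projᶜ v₀ ∷ᶜ []ᶜ) +ᶜ projᶜ v₁)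
    (λ _ _ → refl) (λ { _ x [] → nCk+nC[k+1]≡[n+1]C[k+1] x k })

rankᶜ : ComputableVec {n} {m} F → Computable (λ α xs → rank (F α xs))
rankᶜ {m = m} = compᶜ {h = λ _ ys → rank ys}
  (compᶜ (sumᶜ m) (tabulateᶜ λ i → binomialᶜ (suc (toℕ i)) (projᶜ i)))

-- The largest x with x C suc k ≤ r (see topEntry-spec).
topEntry : ℕ → ℕ → ℕ
topEntry k zero    = k
topEntry k (suc r) = topEntry k r + (1 ∸ (suc (topEntry k r) C suc k ∸ suc r))

-- Greedy decoding in the combinatorial number system: the largest entry is read off first, and the
-- remainder encodes the others.
unrank : ∀ k → ℕ → Vec ℕ k
unrank zero    r = []
unrank (suc k) r = unrank k (r ∸ topEntry k r C suc k) ∷ʳ topEntry k r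

topEntryᶜ : ∀ k → Computable f → Computable (λ α xs → topEntry k (f α xs))
topEntryᶜ k fᶜ = compᶜ {h = λ _ xs → topEntry k (head xs)}
  (recᶜ (constᶜ k)
        (projᶜ v₁ +ᶜ (constᶜ 1 ∸ᶜ (binomialᶜ (suc k) (sucᶜ (projᶜ v₁)) ∸ᶜ sucᶜ (projᶜ v₀))))
        (λ _ _ → refl) (λ _ _ _ → refl))
  (fᶜ ∷ᶜ []ᶜ)

unrankᶜ : ∀ k → Computable f → ComputableVec (λ α xs → unrank k (f α xs))
unrankᶜ zero    fᶜ = []ᶜ
unrankᶜ (suc k) fᶜ = unrankᶜ k (fᶜ ∸ᶜ binomialᶜ (suc k) (topEntryᶜ k fᶜ)) ∷ʳᶜ topEntryᶜ k fᶜ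

-- Triangular numbers are binomials `suc s C 2`, so the pairing is itself a colex rank; `rankᶜ` then
-- computes pairs and `unrank 2` decodes them.
pair≡rank : ∀ n j → pair n j ≡ rank (j ∷ suc (n + j) ∷ [])
pair≡rank n j = trans (+-comm (tri (n + j)) j)
  (cong₂ _+_ (sym (nC1≡n j)) (trans (tri≡C (n + j)) (sym (+-identityʳ _))))
  where
  tri≡C : ∀ s → tri s ≡ suc s C 2
  tri≡C zero    = refl
  tri≡C (suc s) = begin
    tri s + suc s               ≡⟨ +-comm (tri s) (suc s) ⟩
    suc s + tri s               ≡⟨ cong₂ _+_ (sym (nC1≡n (suc s))) (tri≡C s) ⟩
    suc s C 1 + suc s C 2       ≡⟨ nCk+nC[k+1]≡[n+1]C[k+1] (suc s) 1 ⟩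
    suc (suc s) C 2             ∎
    where open ≡-Reasoning

pairᶜ : Computable f → Computable g → Computable (λ α xs → pair (f α xs) (g α xs))
pairᶜ {f = f} {g = g} fᶜ gᶜ =
  extᶜ (λ α xs → sym (pair≡rank (f α xs) (g α xs))) (rankᶜ (gᶜ ∷ᶜ sucᶜ (fᶜ +ᶜ gᶜ) ∷ᶜ []ᶜ))

-- Increasing vectors and their ranks

lookup-∷ʳ : (xs : Vec ℕ n) (x : ℕ) (i : Fin n) → lookup (xs ∷ʳ x) (inject₁ i) ≡ lookup xs i
lookup-∷ʳ (_ ∷ _)  x fzero    = refl
lookup-∷ʳ (_ ∷ xs) x (fsuc i) = lookup-∷ʳ xs x i

Increasing-tail : ∀ {x} {xs : Vec ℕ n} → Increasing (x ∷ xs) → Increasing xs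
Increasing-tail inc i j i<j = inc (fsuc i) (fsuc j) (s≤s i<j)

Increasing-∷ʳ⁻ : (xs : Vec ℕ n) (x : ℕ) → Increasing (xs ∷ʳ x) → Increasing xs
Increasing-∷ʳ⁻ xs x inc i j i<j =
  subst₂ _<_ (lookup-∷ʳ xs x i) (lookup-∷ʳ xs x j)
    (inc (inject₁ i) (inject₁ j) (subst₂ _<_ (sym (toℕ-inject₁ i)) (sym (toℕ-inject₁ j)) i<j))

Increasing-last : (xs : Vec ℕ n) {x y : ℕ} → Increasing (xs ∷ʳ x ∷ʳ y) → x < y
Increasing-last []       inc = inc v₀ v₁ (s≤s z≤n)
Increasing-last (_ ∷ xs) inc = Increasing-last xs (Increasing-tail inc)

Increasing-∷ : ∀ {x} {xs : Vec ℕ (suc n)} → x < head xs → Increasing xs → Increasing (x ∷ xs)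
Increasing-∷ {xs = _ ∷ _} x<y inc fzero    (fsuc fzero)        _         = x<y
Increasing-∷ {xs = _ ∷ _} x<y inc fzero    (fsuc (fsuc j))     _         =
  <-trans x<y (inc fzero (fsuc j) (s≤s z≤n))
Increasing-∷ {xs = _ ∷ _} x<y inc (fsuc i) (fsuc j)            (s≤s i<j) = inc i j i<j

rank-∷ʳ : (xs : Vec ℕ k) (x : ℕ) → rank (xs ∷ʳ x) ≡ rank xs + x C suc k
rank-∷ʳ = go (λ i x → x C suc i)
  where
  -- The weight is arbitrary because removing the first entry shifts the positions of all others.
  go : (w : ℕ → ℕ → ℕ) (xs : Vec ℕ k) (x : ℕ) →
       sum (tabulate λ i → w (toℕ i) (lookup (xs ∷ʳ x) i)) ≡
       sum (tabulate λ i → w (toℕ i) (lookup xs i)) + w k x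
  go w []       x = +-identityʳ _
  go w (y ∷ xs) x = trans (cong (w 0 y +_) (go (w ∘ suc) xs x)) (sym (+-assoc (w 0 y) _ _))

C-suc-≤ : ∀ n k → n C k ≤ suc n C k
C-suc-≤ n zero    = ≤-refl
C-suc-≤ n (suc k) = subst (n C suc k ≤_) (nCk+nC[k+1]≡[n+1]C[k+1] n k) (m≤n+m _ _)

C-monoˡ-≤ : ∀ k {m n} → m ≤ n → m C k ≤ n C k
C-monoˡ-≤ k {n = zero}  z≤n = ≤-refl
C-monoˡ-≤ k {m} {suc n} m≤1+n with m≤n⇒m<n∨m≡n m≤1+n
... | inj₁ (s≤s m≤n) = ≤-trans (C-monoˡ-≤ k m≤n) (C-suc-≤ n k)
... | inj₂ refl      = ≤-refl

C>0 : ∀ {n k} → k ≤ n → 0 < n C k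
C>0 {n} {k} k≤n = ≤-trans (≤-reflexive (sym (nCn≡1 k))) (C-monoˡ-≤ k k≤n)

-- Induction from the top: with `y` the last entry of `xs`, Pascal's rule bounds the rank by
-- `suc y C suc k`, and `suc y ≤ x`.
rank-∷ʳ-bound : (xs : Vec ℕ k) (x : ℕ) → Increasing (xs ∷ʳ x) → rank xs < x C k
rank-∷ʳ-bound {zero}  []  x inc = s≤s z≤n
rank-∷ʳ-bound {suc k} xs  x inc with initLast xs
... | ys , y , refl = begin-strict
  rank (ys ∷ʳ y)          ≡⟨ rank-∷ʳ ys y ⟩
  rank ys + y C suc k     <⟨ +-monoˡ-< _ (rank-∷ʳ-bound ys y (Increasing-∷ʳ⁻ (ys ∷ʳ y) x inc)) ⟩
  y C k + y C suc k       ≡⟨ nCk+nC[k+1]≡[n+1]C[k+1] y k ⟩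
  suc y C suc k           ≤⟨ C-monoˡ-≤ (suc k) (Increasing-last ys inc) ⟩
  x C suc k               ∎
  where open ≤-Reasoning

-- When `r` grows by one, the entry grows by at most one: consecutive binomials here differ by
-- `suc t C k`, which is positive, so a single increment restores the upper bound.
topEntry-spec : ∀ k r → topEntry k r C suc k ≤ r × r < suc (topEntry k r) C suc k
topEntry-spec k zero = ≤-reflexive (k>n⇒nCk≡0 (n<1+n k)) , C>0 {suc k} ≤-refl
topEntry-spec k (suc r) = step (topEntry k r) (topEntry-spec k r)
  where
  step : ∀ t → t C suc k ≤ r × r < suc t C suc k →
         let t′ = t + (1 ∸ (suc t C suc k ∸ suc r)) in
         t′ C suc k ≤ suc r × suc r < suc t′ C suc k
  step t (lo , hi) with suc t C suc k ≤? suc r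
  ... | yes p rewrite m≤n⇒m∸n≡0 p | +-comm t 1 = p , (begin-strict
    suc r                          <⟨ s≤s hi ⟩
    1 + suc t C suc k              ≤⟨ +-monoˡ-≤ _ (C>0 k≤1+t) ⟩
    suc t C k + suc t C suc k      ≡⟨ nCk+nC[k+1]≡[n+1]C[k+1] (suc t) k ⟩
    suc (suc t) C suc k            ∎)
    where
    open ≤-Reasoning
    k≤1+t : k ≤ suc t
    -- Otherwise `suc t C suc k` would be 0, against `hi`.
    k≤1+t = ≮⇒≥ λ 1+t<k → <⇒≱ hi (≤-trans (≤-reflexive (k>n⇒nCk≡0 (m<n⇒m<1+n 1+t<k))) z≤n)
  ... | no ¬p with suc t C suc k ∸ suc r | m<n⇒0<n∸m (≰⇒> ¬p)
  ... | suc w | _ rewrite 0∸n≡0 w | +-identityʳ t = ≤-trans lo (n≤1+n r) , ≰⇒> ¬p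

topEntry-unique : ∀ k r x → x C suc k ≤ r → r < suc x C suc k → topEntry k r ≡ x
topEntry-unique k r x lo hi = ≤-antisym
  (≮⇒≥ λ x<t → <⇒≱ hi (≤-trans (C-monoˡ-≤ (suc k) x<t) (proj₁ (topEntry-spec k r))))
  (≮⇒≥ λ t<x → <⇒≱ (proj₂ (topEntry-spec k r)) (≤-trans (C-monoˡ-≤ (suc k) t<x) lo))

-- The entries before the last one, `y`, contribute less than `y C k`, so the rank lies in the
-- interval from `y C suc k` to `suc y C suc k` that determines `y` as top entry.
unrank-rank : (xs : Vec ℕ k) → Increasing xs → unrank k (rank xs) ≡ xs
unrank-rank {zero}  [] inc = refl
unrank-rank {suc k} xs inc with initLast xs
... | ys , y , refl = begin
  unrank (suc k) r                                ≡⟨ cong (λ t → unrank k (r ∸ t C suc k) ∷ʳ t) top ⟩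
  unrank k (r ∸ y C suc k) ∷ʳ y                   ≡⟨ cong (λ s → unrank k s ∷ʳ y) r∸yC≡ ⟩
  unrank k (rank ys) ∷ʳ y                         ≡⟨ cong (_∷ʳ y) (unrank-rank ys (Increasing-∷ʳ⁻ ys y inc)) ⟩
  ys ∷ʳ y                                         ∎
  where
  open ≡-Reasoning
  r = rank (ys ∷ʳ y)
  r∸yC≡ : r ∸ y C suc k ≡ rank ys
  r∸yC≡ = trans (cong (_∸ y C suc k) (rank-∷ʳ ys y)) (m+n∸n≡m (rank ys) (y C suc k))
  top : topEntry k r ≡ y
  top = topEntry-unique k r y
    (subst (y C suc k ≤_) (sym (rank-∷ʳ ys y)) (m≤n+m _ _))
    (subst₂ _<_ (sym (rank-∷ʳ ys y)) (nCk+nC[k+1]≡[n+1]C[k+1] y k) (+-monoˡ-< _ (rank-∷ʳ-bound ys y inc)))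

-- The reduction

sign : ℕ → ℕ
sign m = 1 ∸ (1 ∸ m)

-- The absolute difference of the two colours, as a sum of truncated differences of which at most
-- one is nonzero.
gap : Baire → Vec ℕ (suc n) → ℕ
gap p B = (colour p (init B) ∸ colour p (tail B)) + (colour p (tail B) ∸ colour p (init B))

opaque
  defect : ℕ → Baire → Baire
  -- `suc` makes the bound inclusive: the colouring whose index is the least element itself is also
  -- tested.
  defect n α r = sign (sumBelow (λ i → gap (component α i) (tail A)) (suc (head A)))
    where
    A : Vec ℕ (2 + n)
    A = unrank (2 + n) r

-- For characteristic functions q: 1 ∸ (i ∸ m) is the truth value of i ≤ m, so x
-- is selected iff it lies in q above some element m ≥ i of q.
above : Baire → ℕ → Baire
above q i x = sign (q x * sumBelow (λ m → (1 ∸ (i ∸ m)) * q m) x)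

-- By pair≡rank, unranking ⟨i,x⟩ as a two-element set gives {x, i + x + 1}.
opaque
  select : Baire → Baire
  select q z = above q (head (tail v) ∸ suc (head v)) (head v)
    where
    v : Vec ℕ 2
    v = unrank 2 z

signᶜ : Computable f → Computable (λ α xs → sign (f α xs))
signᶜ fᶜ = constᶜ 1 ∸ᶜ (constᶜ 1 ∸ᶜ fᶜ)

sign<2 : ∀ m → sign m < 2
sign<2 m = s≤s (m∸n≤m 1 (1 ∸ m))

opaque
  unfolding defect

  defectᶜ : ∀ n → Computable {1} (λ α xs → defect n α (head xs))
  defectᶜ n =
    -- Inside the bounded sum the argument vector carries the summation index in front, hence the
    -- arity 2 and the additional `tailᶜ`.
    let block   = tailᶜ (unrankᶜ (2 + n) (headᶜ (tailᶜ (idᶜ {2}))))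
        initial = oracleᶜ (pairᶜ (headᶜ idᶜ) (rankᶜ (initᶜ block)))
        final   = oracleᶜ (pairᶜ (headᶜ idᶜ) (rankᶜ (tailᶜ block)))
    in signᶜ (sumBelowᶜ ((initial ∸ᶜ final) +ᶜ (final ∸ᶜ initial))
                        (sucᶜ (headᶜ (unrankᶜ (2 + n) (headᶜ idᶜ)))))

  defect<2 : ∀ n α r → defect n α r < 2
  defect<2 n α r = sign<2 (sumBelow _ (suc (head (unrank (2 + n) r))))

opaque
  unfolding select

  selectᶜ : Computable {1} (λ α xs → select α (head xs))
  selectᶜ =
    let v  = unrankᶜ 2 (headᶜ (idᶜ {1}))
        v′ = unrankᶜ 2 (headᶜ (tailᶜ (idᶜ {2})))
    in signᶜ (oracleᶜ (headᶜ v) *ᶜ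
         sumBelowᶜ ((constᶜ 1 ∸ᶜ ((headᶜ (tailᶜ v′) ∸ᶜ sucᶜ (headᶜ v′)) ∸ᶜ headᶜ idᶜ)) *ᶜ oracleᶜ (headᶜ idᶜ))
                   (headᶜ v))

-- Signs and bounded sums

sign≡0⇒≡0 : ∀ m → sign m ≡ 0 → m ≡ 0
sign≡0⇒≡0 zero    _  = refl
sign≡0⇒≡0 (suc m) eq rewrite 0∸n≡0 m = contradiction eq λ ()

≢0⇒sign≡1 : ∀ m → m ≢ 0 → sign m ≡ 1
≢0⇒sign≡1 zero    m≢0 = contradiction refl m≢0
≢0⇒sign≡1 (suc m) _   = cong (1 ∸_) (0∸n≡0 m)

≤-sumBelow : ∀ f {i n} → i < n → f i ≤ sumBelow f n
≤-sumBelow f {i} {suc n} (s≤s i≤n) with m≤n⇒m<n∨m≡n i≤n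
... | inj₁ i<n  = ≤-trans (≤-sumBelow f i<n) (m≤m+n _ _)
... | inj₂ refl = m≤n+m _ _

sumBelow≡0 : ∀ f n → (∀ i → i < n → f i ≡ 0) → sumBelow f n ≡ 0
sumBelow≡0 f zero    f≡0 = refl
sumBelow≡0 f (suc n) f≡0 =
  cong₂ _+_ (sumBelow≡0 f n λ i i<n → f≡0 i (m<n⇒m<1+n i<n)) (f≡0 n ≤-refl)

sumBelow≢0 : ∀ f n → sumBelow f n ≢ 0 → ∃ λ i → i < n × f i ≢ 0
sumBelow≢0 f zero    s≢0 = contradiction refl s≢0
sumBelow≢0 f (suc n) s≢0 with f n ≟ 0
... | no  fn≢0 = n , ≤-refl , fn≢0
... | yes fn≡0 with sumBelow≢0 f n (λ s≡0 → s≢0 (cong₂ _+_ s≡0 fn≡0))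
...   | i , i<n , fi≢0 = i , m<n⇒m<1+n i<n , fi≢0

-- Shift invariance and the new colouring

ShiftInvariant : Baire → Vec ℕ (suc n) → Set
ShiftInvariant p B = colour p (init B) ≡ colour p (tail B)

module _ (α : Baire) {m} {B : Vec ℕ (suc n)} (inc : Increasing (m ∷ B)) where

  private
    total = sumBelow (λ i → gap (component α i) B) (suc m)

    opaque
      unfolding defect

      colour-defect : colour (defect n α) (m ∷ B) ≡ sign total
      colour-defect = cong (λ A → sign (sumBelow (λ i → gap (component α i) (tail A)) (suc (head A))))
                           (unrank-rank (m ∷ B) inc)

  defect≡0⇒shiftInvariant : colour (defect n α) (m ∷ B) ≡ 0 →
                            ∀ i → i ≤ m → ShiftInvariant (component α i) B
  defect≡0⇒shiftInvariant d≡0 i i≤m = ≤-antisym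
    (m∸n≡0⇒m≤n (m+n≡0⇒m≡0 _ gap≡0)) (m∸n≡0⇒m≤n (m+n≡0⇒n≡0 _ gap≡0))
    where
    gap≡0 : gap (component α i) B ≡ 0
    gap≡0 = n≤0⇒n≡0 (≤-trans (≤-sumBelow (λ i → gap (component α i) B) (s≤s i≤m))
      (≤-reflexive (sign≡0⇒≡0 total (trans (sym colour-defect) d≡0))))

  shiftInvariant⇒defect≡0 : (∀ i → i ≤ m → ShiftInvariant (component α i) B) →
                            colour (defect n α) (m ∷ B) ≡ 0
  shiftInvariant⇒defect≡0 inv = trans colour-defect (cong sign (sumBelow≡0 _ (suc m) gap≡0))
    where
    gap≡0 : ∀ i → i < suc m → gap (component α i) B ≡ 0
    gap≡0 i (s≤s i≤m) = cong₂ _+_ (m≤n⇒m∸n≡0 (≤-reflexive (inv i i≤m)))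
                                  (m≤n⇒m∸n≡0 (≤-reflexive (sym (inv i i≤m))))

-- The sets extracted from a homogeneous set

opaque
  unfolding select

  component-select : ∀ q i x → component (select q) i x ≡ above q i x
  component-select q i x = begin
    select q (pair i x)              ≡⟨ cong (select q) (pair≡rank i x) ⟩
    select q (rank v)                ≡⟨ cong (λ w → above q (head (tail w) ∸ suc (head w)) (head w))
                                             (unrank-rank v inc) ⟩
    above q (i + x ∸ x) x            ≡⟨ cong (λ j → above q j x) (m+n∸n≡m i x) ⟩
    above q i x                      ∎
    where
    open ≡-Reasoning
    v : Vec ℕ 2
    v = x ∷ suc (i + x) ∷ []
    inc : Increasing v
    inc fzero (fsuc fzero) _ = s≤s (m≤n+m x i)
    inc (fsuc fzero) (fsuc fzero) (s≤s ())

above-charFn : ∀ q i → CharFn (above q i)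
above-charFn q i x with q x * sumBelow (λ m → (1 ∸ (i ∸ m)) * q m) x ≟ 0
... | yes s≡0 = inj₁ (cong sign s≡0)
... | no  s≢0 = inj₂ (≢0⇒sign≡1 _ s≢0)

module _ {q} (char : CharFn q) where

  private
    ≢0⇒≡1 : ∀ {x} → q x ≢ 0 → q x ≡ 1
    ≢0⇒≡1 {x} qx≢0 with char x
    ... | inj₁ qx≡0 = contradiction qx≡0 qx≢0
    ... | inj₂ qx≡1 = qx≡1

  -- A nonzero product has nonzero factors; a nonzero term of the bounded sum then supplies the
  -- witness `m`.
  above-sound : ∀ i x → above q i x ≡ 1 → q x ≡ 1 × ∃ λ m → m < x × i ≤ m × q m ≡ 1
  above-sound i x eq =
    let m , m<x , t≢0 = sumBelow≢0 weight x sum≢0 in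
    ≢0⇒≡1 (λ qx≡0 → contradiction (trans (sym eq) (cong (λ y → sign (y * sumBelow weight x)) qx≡0)) λ ())
    , m , m<x
    , m∸n≡0⇒m≤n (zero-of _ λ e → t≢0 (cong (_* q m) e))
    , ≢0⇒≡1 (λ qm≡0 → t≢0 (trans (cong ((1 ∸ (i ∸ m)) *_) qm≡0) (*-zeroʳ (1 ∸ (i ∸ m)))))
    where
    weight : ℕ → ℕ
    weight m = (1 ∸ (i ∸ m)) * q m
    sum≢0 : sumBelow weight x ≢ 0
    sum≢0 s≡0 = contradiction
      (trans (sym eq) (cong sign (trans (cong (q x *_) s≡0) (*-zeroʳ (q x))))) λ ()
    zero-of : ∀ k → 1 ∸ k ≢ 0 → k ≡ 0
    zero-of zero    _ = refl
    zero-of (suc k) e = contradiction (0∸n≡0 k) e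

  above-complete : ∀ i x {m} → m < x → i ≤ m → q m ≡ 1 → q x ≡ 1 → above q i x ≡ 1
  above-complete i x {m} m<x i≤m qm≡1 qx≡1 = ≢0⇒sign≡1 _ λ s≡0 →
    <⇒≱ (≤-trans (≤-reflexive (sym weight≡1)) (≤-sumBelow weight m<x))
        (≤-reflexive (trans (sym (trans (cong (_* sumBelow weight x) qx≡1) (*-identityˡ _))) s≡0))
    where
    weight : ℕ → ℕ
    weight m = (1 ∸ (i ∸ m)) * q m
    weight≡1 : weight m ≡ 1
    weight≡1 = cong₂ (λ a b → (1 ∸ a) * b) (m≤n⇒m∸n≡0 i≤m) qm≡1

  above-infinite : Infinite q → ∀ i → Infinite (above q i)
  above-infinite inf i b
    with m , i≤m , qm≡1 ← inf i
    -- The bound `b + suc m` puts `x` at or above `b` and strictly above the witness `m`.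
    with x , b+m<x , qx≡1 ← inf (b + suc m)
    = x , ≤-trans (m≤m+n b _) b+m<x
    , above-complete i x (≤-trans (m≤n+m _ b) b+m<x) i≤m qm≡1 qx≡1

-- Strictly increasing sequences

StrictlyIncreasing : (ℕ → ℕ) → Set
StrictlyIncreasing g = ∀ j → g j < g (suc j)

mono-< : ∀ {g} → StrictlyIncreasing g → ∀ {i j} → i < j → g i < g j
mono-< inc {i} {suc j} (s≤s i≤j) with m≤n⇒m<n∨m≡n i≤j
... | inj₁ i<j  = <-trans (mono-< inc i<j) (inc j)
... | inj₂ refl = inc i

n≤g[n] : ∀ {g} → StrictlyIncreasing g → ∀ n → n ≤ g n
n≤g[n] inc zero    = z≤n
n≤g[n] inc (suc n) = ≤-trans (s≤s (n≤g[n] inc n)) (inc n)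

Increasing-map : ∀ {g} → StrictlyIncreasing g → {xs : Vec ℕ n} → Increasing xs → Increasing (map g xs)
Increasing-map {g = g} inc {xs} incxs i j i<j =
  subst₂ _<_ (sym (lookup-map i g xs)) (sym (lookup-map j g xs)) (mono-< inc (incxs i j i<j))

-- Windows of a sequence and finite prefixes

window : ∀ n → (ℕ → ℕ) → Vec ℕ n
window n g = tabulate (g ∘ toℕ)

Increasing-window : ∀ {g} → StrictlyIncreasing g → Increasing (window n g)
Increasing-window {g = g} inc i j i<j =
  subst₂ _<_ (sym (lookup∘tabulate (g ∘ toℕ) i)) (sym (lookup∘tabulate (g ∘ toℕ) j)) (mono-< inc i<j)

init-window : ∀ n g → init (window (suc n) g) ≡ window n g
init-window zero    g = refl
init-window (suc n) g = cong (g 0 ∷_) (init-window n (g ∘ suc))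

init-map : ∀ (g : ℕ → ℕ) (xs : Vec ℕ (suc n)) → init (map g xs) ≡ map g (init xs)
init-map g (x ∷ [])         = refl
init-map g (x ∷ xs@(_ ∷ _)) = cong (g x ∷_) (init-map g xs)

splice : Vec ℕ n → (ℕ → ℕ) → ℕ → ℕ
splice []       e         = e
splice (x ∷ xs) e zero    = x
splice (x ∷ xs) e (suc j) = splice xs e j

window-splice : (xs : Vec ℕ n) (e : ℕ → ℕ) → window n (splice xs e) ≡ xs
window-splice []       e = refl
window-splice (x ∷ xs) e = cong (x ∷_) (window-splice xs e)

splice-+ : (xs : Vec ℕ n) (e : ℕ → ℕ) (j : ℕ) → splice xs e (n + j) ≡ e j
splice-+ []       e j = refl
splice-+ (x ∷ xs) e j = splice-+ xs e j

splice-all : {P : ℕ → Set} (xs : Vec ℕ n) {e : ℕ → ℕ} →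
             (∀ i → P (lookup xs i)) → (∀ j → P (e j)) → ∀ j → P (splice xs e j)
splice-all []       Pxs Pe j       = Pe j
splice-all (x ∷ xs) Pxs Pe zero    = Pxs fzero
splice-all {P = P} (x ∷ xs) Pxs Pe (suc j) = splice-all {P = P} xs (Pxs ∘ fsuc) Pe j

splice-increasing : (xs : Vec ℕ n) {e : ℕ → ℕ} → Increasing xs → StrictlyIncreasing e →
                    (∀ i → lookup xs i < e 0) → StrictlyIncreasing (splice xs e)
splice-increasing []           incxs ince xs<e j       = ince j
splice-increasing (x ∷ [])     incxs ince xs<e zero    = xs<e fzero
splice-increasing (x ∷ y ∷ xs) incxs ince xs<e zero    = incxs v₀ v₁ (s≤s z≤n)
splice-increasing (x ∷ xs)     incxs ince xs<e (suc j) =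
  splice-increasing xs (Increasing-tail incxs) ince (xs<e ∘ fsuc) j

-- A crude common bound on all entries, used to choose where the continuation of a finite vector may
-- start.
lookup≤sum : (xs : Vec ℕ n) (i : Fin n) → lookup xs i ≤ sum xs
lookup≤sum (x ∷ xs) fzero    = m≤m+n x _
lookup≤sum (x ∷ xs) (fsuc i) = ≤-trans (lookup≤sum xs i) (m≤n+m _ x)

module _ {q} (inf : Infinite q) where

  enumerate : ℕ → ℕ
  enumerate zero    = proj₁ (inf 0)
  enumerate (suc j) = proj₁ (inf (suc (enumerate j)))

  enumerate-increasing : StrictlyIncreasing enumerate
  enumerate-increasing j = proj₁ (proj₂ (inf (suc (enumerate j))))

  enumerate-∈ : ∀ j → q (enumerate j) ≡ 1
  enumerate-∈ zero    = proj₂ (proj₂ (inf 0))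
  enumerate-∈ (suc j) = proj₂ (proj₂ (inf (suc (enumerate j))))

-- Sliding a window along a sequence in q does not change its colour, and any
-- increasing vector in q can be continued by a tail of the enumeration of q.
shiftInvariant⇒homogeneous : ∀ p {q} → Infinite q →
  ((B : Vec ℕ (suc n)) → Increasing B → (∀ i → q (lookup B i) ≡ 1) → ShiftInvariant p B) →
  Homogeneous n p q
shiftInvariant⇒homogeneous {n} p {q} inf inv = colour p (window n e) , λ A incA A∈q →
  -- Since `N ≤ e N`, the enumeration from index `N` on lies beyond every entry of `A`.
  let N = suc (sum A)
      g = splice A (λ j → e (N + j))
      incg = splice-increasing A incA
        (λ j → subst (λ k → e (N + j) < e k) (sym (+-suc N j)) (e↑ (N + j)))
        (λ i → ≤-trans (s≤s (lookup≤sum A i))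
                 (≤-trans (n≤g[n] e↑ N) (≤-reflexive (cong e (sym (+-identityʳ N))))))
      g∈q = splice-all {P = λ x → q x ≡ 1} A {λ j → e (N + j)} A∈q (λ j → enumerate-∈ inf (N + j))
  in begin
  colour p A                             ≡⟨ cong (colour p) (sym (window-splice A _)) ⟩
  -- Sliding `g` by `n` leaves all of `A` behind; sliding `e` by `N` reaches the same window.
  colour p (window n g)                  ≡⟨ slide n incg g∈q ⟩
  colour p (window n (λ j → g (n + j)))  ≡⟨ cong (colour {n} p) (tabulate-cong λ j →
                                              splice-+ A (λ j → e (N + j)) (toℕ j)) ⟩
  colour p (window n (λ j → e (N + j)))  ≡⟨ sym (slide N e↑ (enumerate-∈ inf)) ⟩
  colour p (window n e)                  ∎
  where
  open ≡-Reasoning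
  e = enumerate inf
  e↑ = enumerate-increasing inf
  slide : ∀ N {g} → StrictlyIncreasing g → (∀ j → q (g j) ≡ 1) →
          colour p (window n g) ≡ colour p (window n (λ j → g (N + j)))
  slide zero    inc g∈q = refl
  slide (suc N) {g} inc g∈q = begin
    colour p (window n g)                ≡⟨ cong (colour p) (sym (init-window n g)) ⟩
    -- A window of length `suc n` has the current window as `init` and the shifted one as `tail`.
    colour p (init (window (suc n) g))   ≡⟨ inv (window (suc n) g) (Increasing-window inc)
                                              (λ i → trans (cong q (lookup∘tabulate (g ∘ toℕ) i)) (g∈q (toℕ i))) ⟩
    colour p (window n (g ∘ suc))        ≡⟨ slide N (inc ∘ suc) (g∈q ∘ suc) ⟩
    colour p (window n (λ j → g (suc N + j))) ∎

-- The shift graph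

module _ (c : Vec ℕ (2 + n) → Fin k) (A : Vec ℕ (suc n)) (col : Fin k) where

  private
    extension? : Dec (∃ λ x → x < head A × c (x ∷ A) ≡ col)
    extension? = anyUpTo? (λ x → c (x ∷ A) ≟ᶠ col) (head A)

  -- The indicator at `col` of the set of colours of `A`'s extensions; with values in `Fin 2`,
  -- `funToFin` codes the whole set in `Fin (2 ^ k)`.
  extends : Fin 2
  extends with extension?
  ... | yes _ = v₁
  ... | no  _ = v₀

  extends-sound : extends ≡ v₁ → ∃ λ x → x < head A × c (x ∷ A) ≡ col
  extends-sound eq with extension?
  ... | yes ext = ext

  extends-complete : ∀ {x} → x < head A → c (x ∷ A) ≡ col → extends ≡ v₁
  extends-complete {x} x<A eq with extension?
  ... | yes _   = refl
  ... | no ¬ext = contradiction (x , x<A , eq) ¬ext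

-- Colour A by the set of all c (x ∷ A) with x below A.  If init B and tail B get
-- the same set, it contains c B, so c B = c (x ∷ init B) for some x below B.
shiftGraph-improper : ∀ n k (c : Vec ℕ (suc n) → Fin k) →
  ∃ λ B → Increasing B × c (init B) ≡ c (tail B)
shiftGraph-improper zero k c
  with i , j , i<j , eq ← pigeonhole (n<1+n k) (λ i → c (toℕ i ∷ []))
  = toℕ i ∷ toℕ j ∷ [] , inc , eq
  where
  inc : Increasing (toℕ i ∷ toℕ j ∷ [])
  inc fzero        (fsuc fzero) _ = i<j
  inc (fsuc fzero) (fsuc fzero) (s≤s ())
shiftGraph-improper (suc n) k c
  with b ∷ B@(_ ∷ _) , inc , eq ← shiftGraph-improper n (2 ^ k) (funToFin ∘ extends c) =
  let x , x<b , cx≡ = extends-sound c (b ∷ init B) (c (b ∷ B)) (begin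
        extends c (b ∷ init B) (c (b ∷ B))
          ≡⟨ finToFun-funToFin (extends c (b ∷ init B)) (c (b ∷ B)) ⟨
        finToFun (funToFin (extends c (b ∷ init B))) (c (b ∷ B))
          ≡⟨ cong (λ s → finToFun s (c (b ∷ B))) eq ⟩
        finToFun (funToFin (extends c B)) (c (b ∷ B))
          ≡⟨ finToFun-funToFin (extends c B) (c (b ∷ B)) ⟩
        extends c B (c (b ∷ B))
          ≡⟨ extends-complete c B (c (b ∷ B)) (inc v₀ v₁ (s≤s z≤n)) refl ⟩
        v₁ ∎)
  in x ∷ b ∷ B , Increasing-∷ x<b inc , cx≡
  where open ≡-Reasoning

-- The colourings with index up to `m` merge into one, whose colour is the tuple of their values;
-- there are `b ^ suc m` such tuples.
shiftGraph-improper-simultaneous :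
  ∀ (c : ℕ → Vec ℕ (suc n) → ℕ) → (∀ i → ∃ λ b → ∀ A → c i A < b) → ∀ m →
  ∃ λ B → Increasing B × (∀ i → i ≤ m → c i (init B) ≡ c i (tail B))
shiftGraph-improper-simultaneous {n} c bounded m =
  let B , inc , eq = shiftGraph-improper n (b ^ suc m) (funToFin ∘ colours) in
  B , inc , λ i i≤m → subst (λ j → c j (init B) ≡ c j (tail B)) (toℕ-fromℕ< (s≤s i≤m))
      (fromℕ<-injective _ _ (c<b (init B) _) (c<b (tail B) _)
        (trans (sym (finToFun-funToFin (colours (init B)) (fromℕ< (s≤s i≤m))))
        (trans (cong (λ f → finToFun f (fromℕ< (s≤s i≤m))) eq)
               (finToFun-funToFin (colours (tail B)) (fromℕ< (s≤s i≤m))))))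
  where
  b : ℕ
  -- The sum of the separate bounds is a common bound.
  b = sumBelow (λ i → proj₁ (bounded i)) (suc m)
  c<b : ∀ A (i : Fin (suc m)) → c (toℕ i) A < b
  c<b A i = <-≤-trans (proj₂ (bounded (toℕ i)) A) (≤-sumBelow (λ i → proj₁ (bounded i)) (toℕ<n i))
  colours : Vec ℕ (suc n) → Fin (suc m) → Fin b
  colours A i = fromℕ< (c<b A i)

-- Correctness of the reduction

Bounded : Baire → Set
Bounded p = ∃ λ b → ∀ i → p i < b

inRange⇒bounded : ∀ K {p} → InRange K p → Bounded p
inRange⇒bounded (fin k) p<k = k , p<k
inRange⇒bounded omega   bd  = bd

module _ {p} (bounded : ∀ i → Bounded (component p i))
         {q} (sol : RTsol (3 + n) (defect (suc n) p) q) where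

  private
    char = proj₁ sol
    inf  = proj₁ (proj₂ sol)
    col  = proj₁ (proj₂ (proj₂ sol))
    hom  = proj₂ (proj₂ (proj₂ sol))

    e  = enumerate inf
    e↑ = enumerate-increasing inf

    block-∈ : (B : Vec ℕ k) → ∀ j → q (lookup (e 0 ∷ map (e ∘ suc) B) j) ≡ 1
    block-∈ B fzero    = enumerate-∈ inf 0
    block-∈ B (fsuc j) = trans (cong q (lookup-map j (e ∘ suc) B)) (enumerate-∈ inf (suc (lookup B j)))

    block-increasing : {B : Vec ℕ (suc k)} → Increasing B → Increasing (e 0 ∷ map (e ∘ suc) B)
    block-increasing {B = x ∷ xs} inc =
      Increasing-∷ (mono-< e↑ {0} {suc x} (s≤s z≤n)) (Increasing-map (e↑ ∘ suc) {x ∷ xs} inc)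

    -- Pulling the colourings back along the enumeration after `e 0` turns a shift-graph witness
    -- among all numbers into one inside `q`.
    blockColour : ℕ → Vec ℕ (suc n) → ℕ
    blockColour i A = colour (component p i) (map (e ∘ suc) A)

    Improper : Vec ℕ (2 + n) → Set
    Improper B = ∀ i → i ≤ e 0 → blockColour i (init B) ≡ blockColour i (tail B)

    block-colour≡0 : (B : Vec ℕ (2 + n)) → Increasing B → Improper B →
      colour (defect (suc n) p) (e 0 ∷ map (e ∘ suc) B) ≡ 0
    block-colour≡0 B@(_ ∷ _) inc inv =
      shiftInvariant⇒defect≡0 {n = suc n} p {e 0} {map (e ∘ suc) B} (block-increasing inc)
      λ i i≤m → trans (cong (colour (component p i)) (init-map (e ∘ suc) B)) (inv i i≤m)

    improper : ∃ λ B → Increasing B × Improper B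
    improper = shiftGraph-improper-simultaneous blockColour
      (λ i → proj₁ (bounded i) , λ A → proj₂ (bounded i) _) (e 0)

    block-colour≡col : (B : Vec ℕ (2 + n)) → Increasing B →
      colour (defect (suc n) p) (e 0 ∷ map (e ∘ suc) B) ≡ col
    block-colour≡col B inc = hom (e 0 ∷ map (e ∘ suc) B) (block-increasing inc) (block-∈ B)

    colour≡0 : (∃ λ B → Increasing B × Improper B) → col ≡ 0
    colour≡0 (B , inc , inv) = trans (sym (block-colour≡col B inc)) (block-colour≡0 B inc inv)

  -- One block in `q` on which every colouring with index up to `e 0` is shift invariant has colour
  -- 0, and homogeneity makes this the colour of all of them.
  defect-colour≡0 : col ≡ 0
  defect-colour≡0 = colour≡0 improper

  -- Below the first element of `B` there is some `m` in `q` with `i ≤ m`; the block `m ∷ B` has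
  -- colour 0 and tests index `i`.
  above-shiftInvariant : ∀ i (B : Vec ℕ (2 + n)) → Increasing B →
    (∀ j → above q i (lookup B j) ≡ 1) → ShiftInvariant (component p i) B
  above-shiftInvariant i B@(b ∷ _) inc B∈
    with _ , m , m<b , i≤m , qm≡1 ← above-sound char i b (B∈ fzero)
    = defect≡0⇒shiftInvariant p inc′ (trans (hom (m ∷ B) inc′ ∈q) defect-colour≡0) i i≤m
    where
    inc′ : Increasing (m ∷ B)
    inc′ = Increasing-∷ m<b inc
    ∈q : ∀ j → q (lookup (m ∷ B) j) ≡ 1
    ∈q fzero    = qm≡1
    ∈q (fsuc j) = proj₁ (above-sound char i _ (B∈ j))

  select-solves : ∀ i → RTsol (suc n) (component p i) (component (select q) i)
  select-solves i =
      (λ x → subst (λ y → y ≡ 0 ⊎ y ≡ 1) (sym (component-select q i x)) (above-charFn q i x))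
    , (λ b → let x , b≤x , eq = above-infinite char inf i b
             in x , b≤x , trans (component-select q i x) eq)
    , proj₁ above-homogeneous
    , λ A inc A∈ → proj₂ above-homogeneous A inc λ j → trans (sym (component-select q i _)) (A∈ j)
    where
    above-homogeneous : Homogeneous (suc n) (component p i) (above q i)
    above-homogeneous = shiftInvariant⇒homogeneous (component p i) (above-infinite char inf i)
                                                   (above-shiftInvariant i)

-- As the last element `j` varies, `init` of the block remains `B` and only `B′ ∷ʳ j` changes. Its
-- colours under the finitely many tested colourings converge, so the limit is 0 or 1 according to
-- whether `B` already has all the limit colours, which is decidable.
defect-stable : ∀ n {p} → (∀ i → Stable (suc n) (component p i)) → Stable (3 + n) (defect (suc n) p)
defect-stable n {p} stable (m ∷ B@(_ ∷ B′)) inc = answer (allUpTo? limit? (suc m))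
  where
  incB′ : Increasing B′
  incB′ = Increasing-tail (Increasing-tail inc)
  limit : ℕ → ℕ
  limit i = proj₁ (stable i B′ incB′)
  threshold : ℕ → ℕ
  threshold i = proj₁ (proj₂ (stable i B′ incB′))
  AgreesWithLimit : ℕ → Set
  AgreesWithLimit i = colour (component p i) B ≡ limit i
  limit? : ∀ i → Dec (AgreesWithLimit i)
  limit? i = colour (component p i) B ≟ limit i
  -- The sum dominates the thresholds of all tested indices at once.
  N = sumBelow threshold (suc m)

  module _ (j : ℕ) (N<j : N < j) (incj : Increasing (m ∷ (B ∷ʳ j))) where
    at-limit : ∀ i → i ≤ m → colour (component p i) (B′ ∷ʳ j) ≡ limit i
    at-limit i i≤m = proj₂ (proj₂ (stable i B′ incB′)) j
      (≤-<-trans (≤-sumBelow threshold (s≤s i≤m)) N<j)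
      (Increasing-tail (Increasing-tail incj))
    zero-if : (∀ {i} → i < suc m → AgreesWithLimit i) →
              colour (defect (suc n) p) (m ∷ (B ∷ʳ j)) ≡ 0
    zero-if agrees = shiftInvariant⇒defect≡0 p incj λ i i≤m →
      trans (cong (colour (component p i)) (init-∷ʳ j B)) (trans (agrees (s≤s i≤m)) (sym (at-limit i i≤m)))
    zero-only-if : colour (defect (suc n) p) (m ∷ (B ∷ʳ j)) ≡ 0 →
                   ∀ {i} → i < suc m → AgreesWithLimit i
    zero-only-if d≡0 {i} (s≤s i≤m) = trans (sym (cong (colour (component p i)) (init-∷ʳ j B)))
      (trans (defect≡0⇒shiftInvariant p incj d≡0 i i≤m) (at-limit i i≤m))

  bit-≢0 : ∀ {d} → d < 2 → d ≢ 0 → d ≡ 1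
  bit-≢0 {zero}        _              d≢0 = contradiction refl d≢0
  bit-≢0 {suc zero}    _              _   = refl
  bit-≢0 {suc (suc _)} (s≤s (s≤s ())) _

  answer : Dec (∀ {i} → i < suc m → AgreesWithLimit i) →
    Σ ℕ λ col → Σ ℕ λ N → ∀ j → N < j → Increasing (m ∷ (B ∷ʳ j)) →
      colour (defect (suc n) p) (m ∷ (B ∷ʳ j)) ≡ col
  answer (yes agrees) = 0 , N , λ j N<j incj → zero-if j N<j incj agrees
  answer (no ¬agrees) = 1 , N , λ j N<j incj →
    bit-≢0 (defect<2 _ _ _) λ d≡0 → ¬agrees (zero-only-if j N<j incj d≡0)

-- The same two functionals serve the general and the stable case, which differ only in the domain
-- conditions. `select` receives `q` alone, as strong reducibility demands.
reduction : ∀ n f g →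
  (∀ p → Dom (parallel f) p → ∀ i → Bounded (component p i)) →
  (∀ p → Dom (parallel f) p → Dom g (defect (suc n) p)) →
  (∀ p q → RTsol (suc n) p q → Sol f p q) →
  (∀ p q → Sol g p q → RTsol (3 + n) p q) →
  parallel f ≤sW g
reduction n f g bounded dom sol-f sol-g =
  code (defectᶜ (suc n)) , code selectᶜ , λ (G , G-sol) p dp →
    let k = defect (suc n) p
        d = dom p dp
        q = G k d
    in
    k , (λ j → eval (defectᶜ (suc n)) p (j ∷ [])) , d ,
    select q , (λ j → eval selectᶜ q (j ∷ [])) ,
    λ i → sol-f (component p i) (component (select q) i)
            (select-solves (bounded p dp) (sol-g k q (G-sol k d)) i)

theorem3p28 : (n : ℕ) → 1 ≤ n → (k : Colours) → ValidColours k →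
    (parallel (RT n k) ≤sW RT (n + 2) (fin 2)) × (parallel (SRT n k) ≤sW SRT (n + 2) (fin 2))
-- The rewrite brings the exponent `suc n + 2` into the form `3 + n`.
theorem3p28 (suc n) _ k _ rewrite +-comm n 2 =
  reduction n (RT (suc n) k) (RT (3 + n) (fin 2))
            (λ p dp i → inRange⇒bounded k (dp i))
            (λ p dp r → defect<2 _ p r)
            (λ p q sol → sol) (λ p q sol → sol) ,
  reduction n (SRT (suc n) k) (SRT (3 + n) (fin 2))
            (λ p dp i → inRange⇒bounded k (proj₁ (dp i)))
            (λ p dp → (λ r → defect<2 _ p r) , defect-stable n (λ i → proj₂ (dp i)))
            (λ p q sol → sol) (λ p q sol → sol)
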